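{- Let $\mathcal{L}$ be a finite relational language and $\mathcal{T}$ a finite set of finite $\mathcal{L}$-structures. Let $C$ be a finite $\mathcal{T}$-free $\mathcal{L}$-structure, with a fixed natural factorization $\{(C_i,a_i): i=1,\dots,n\}$, and let $(D,\phi)$ be a finite $\mathcal{T}$-free, minimal HL-extension of $C$. Then there are normal subgroups $N_1,\dots,N_n\unlhd\mathbb{F}(\mathcal{P}_C)$ of finite index such that $(\Gamma_{\vec N},\Phi_{\vec N})$ is a finite $\mathcal{T}$-free, minimal HL-extension of $C$ and there is a homomorphism from $(\Gamma_{\vec N},\Phi_{\vec N})$ onto $(D,\phi)$.
   Context: Basic notions. A homomorphism $h:M\to N$ of $\mathcal{L}$-structures is a map such that $R^M(b_1,\dots,b_m)$ implies $R^N(h(b_1),\dots,h(b_m))$ for every $m$-ary $R\in\mathcal{L}$. $M$ is $\mathcal{T}$-free if no $T\in\mathcal{T}$ admits a homomorphism $T\to M$. $D$ is an extension of $C$ if $C$ is a substructure of $D$; the same terminology is used when $D$ contains an isomorphic copy of $C$. HL-extensions. A partial isomorphism of $C$ is an isomorphism between two finite substructures of $C$. $\mathcal{P}_C$ is the set of partial isomorphisms of $C$ that are not restrictions of the identity $1_C$. An HL-extension of $C$ is a pair $(D,\phi)$ where $D$ is an extension of $C$ and $\phi:\mathcal{P}_C\to\mathrm{Aut}(D)$ is such that $\phi(p)$ extends $p$ for all $p\in\mathcal{P}_C$; it is tacitly assumed that $\phi(p^{ -1})=\phi(p)^{ -1}$. It is finite ($\mathcal{T}$-free) if $D$ is. It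 is minimal if for every $b\in D\setminus C$ there are $p_1,\dots,p_k\in\mathcal{P}_C$ and $a\in C$ with $b=\phi(p_1)\cdots\phi(p_k)(a)$. A homomorphism from an HL-extension $(D_1,\phi_1)$ of $C$ to an HL-extension $(D_2,\phi_2)$ of $C$ is a homomorphism of structures $\psi:D_1\to D_2$ that is the identity on $C$ and satisfies $\psi\circ\phi_1(p)=\phi_2(p)\circ\psi$ for all $p\in\mathcal{P}_C$. Natural factorization. There is a unique partition of $C$ into substructures $C_1,\dots,C_n$ such that each $C_i$ is a maximal subset of $C$ with the property that for all $a,b\in C_i$ the map $\{(a,b)\}$ is a partial isomorphism of $C$. A natural factorization of $C$ is this partition together with a chosen point $a_i\in C_i$ for each $i$, written $\{(C_i,a_i):i=1,\dots,n\}$. Groups. $\mathbb{F}(\mathcal{P}_C)$ is the free group with generating set $\mathcal{P}_C$, with the convention that the inverse of $p\in\mathcal{P}_C$ in $\mathbb{F}(\mathcal{P}_C)$ coincides with $p^{ -1}$. For each $i$, $H_i=\{g\in\mathbb{F}(\mathcal{P}_C): g(a_i)=a_i\}$, where $g(a_i)=a_i$ means that if $g=p_1\cdots p_m$ with $p_1,\dots,p_m\in\mathcal{P}_C$, then $p_1(\cdots(p_m(a_i))\cdots)$ is defined and equals $a_i$. Each $H_i$ is a subgroup of $\mathbb{F}(\mathcal{P}_C)$. The pair $(\Gamma_{\vec N},\Phi_{\vec N})$. For normal subgroups $N_1,\dots,N_n\unlhd\mathbb{F}(\mathcal{P}_C)$ of finite index, $\Gamma_{\vec N}$ is the $\mathcal{L}$-structure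 with domain the disjoint union $\mathbb{F}(\mathcal{P}_C)/N_1H_1\sqcup\cdots\sqcup\mathbb{F}(\mathcal{P}_C)/N_nH_n$ of sets of left cosets. For an $m$-ary $R\in\mathcal{L}$, $R^{\Gamma_{\vec N}}(g_1N_{i_1}H_{i_1},\dots,g_mN_{i_m}H_{i_m})$ holds iff there are $p_1,\dots,p_m\in\mathcal{P}_C$ and $g\in\mathbb{F}(\mathcal{P}_C)$ such that $p_j(a_{i_j})$ is defined for each $j=1,\dots,m$, $(g_1N_{i_1}H_{i_1},\dots,g_mN_{i_m}H_{i_m})=(gp_1N_{i_1}H_{i_1},\dots,gp_mN_{i_m}H_{i_m})$, and $R^C(p_1(a_{i_1}),\dots,p_m(a_{i_m}))$. The map $\pi_{\vec N}:C\to\Gamma_{\vec N}$ is given, for $a\in C_i$, by $\pi_{\vec N}(a)=N_iH_i$ if $a=a_i$, and $\pi_{\vec N}(a)=pN_iH_i$ if $a\ne a_i$ and $p\in\mathcal{P}_C$ satisfies $p(a_i)=a$. When $\pi_{\vec N}$ is an isomorphic embedding, $\Gamma_{\vec N}$ is regarded as an extension of $C$ via $\pi_{\vec N}$; this is the sense in which $(\Gamma_{\vec N},\Phi_{\vec N})$ is an HL-extension of $C$. The map $\Phi_{\vec N}:\mathcal{P}_C\to\mathrm{Aut}(\Gamma_{\vec N})$ is defined by $\Phi_{\vec N}(p)(gN_iH_i)=pgN_iH_i$.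
   Formalization: In the definition of R^Γ the maps p_1,…,p_m may also be the identity 1_C, not only members of P_C; otherwise the claim fails for C={a} with R(a), where P_C is empty. Finite structures are taken with decidable relations, which is automatic classically. -}

module Defs where

open import Algebra.Bundles using (Group)
open import Data.Fin.Base using (Fin)
open import Data.Fin.Properties using (inj⇒≟)
open import Data.List.Base using (List; []; _∷_; _++_; [_]; foldr)
open import Data.List.Properties using (++-assoc; ++-identityʳ)
open import Data.List.Relation.Unary.All using (All)
open import Data.Maybe.Base using (Maybe; just; nothing; maybe′)
open import Data.Maybe.Relation.Binary.Pointwise using (Pointwise; just; nothing)
open import Data.Maybe.Relation.Unary.Any using (Any; just)
open import Data.Nat.Base using (ℕ)
open import Data.Product.Base using (Σ; Σ-syntax; ∃-syntax; _×_; _,_; proj₁; proj₂)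
open import Function.Base using (_∘_)
open import Function.Bundles using (Inverse; Equivalence; _⇔_; mk⇔)
open import Function.Properties.Inverse using (Inverse⇒Injection)
open import Function.Definitions using (Congruent; Injective)
open import Level using (0ℓ; suc)
open import Relation.Binary.Bundles using (Setoid)
open import Relation.Binary.Core using (Rel)
open import Relation.Binary.Definitions using (Decidable)
open import Relation.Binary.PropositionalEquality.Core as ≡ using (_≡_)
open import Relation.Binary.PropositionalEquality.Properties as ≡ using ()
open import Relation.Nullary.Decidable.Core using (Dec; yes; no)
open import Relation.Nullary.Negation.Core using (¬_; contradiction)
open import Relation.Unary using (Pred)
import Algebra.Properties.Group as GroupProperties
import Relation.Binary.Reasoning.Setoid as SetoidReasoning

record Language : Set where
  field
    size  : ℕ
    arity : Fin size → ℕ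

  Symbol : Set
  Symbol = Fin size

open Language using (Symbol; arity)

-- Domains are setoids, because a set of cosets has no quotient type.
record Structure (L : Language) : Set (suc 0ℓ) where
  field
    domain : Setoid 0ℓ 0ℓ

  open Setoid domain public

  field
    rel      : (R : Symbol L) → (Fin (arity L R) → Carrier) → Set
    rel-resp : ∀ R {x y : Fin (arity L R) → Carrier} →
               (∀ j → x j ≈ y j) → rel R x → rel R y

FiniteSetoid : Setoid 0ℓ 0ℓ → Set
FiniteSetoid S = Σ[ k ∈ ℕ ] Inverse S (≡.setoid (Fin k))

-- A finite structure has finitely many points and its relations are
-- finite tables; the second part is automatic classically.
record IsFinite {L : Language} (A : Structure L) : Set where
  open Structure A
  field
    finite-domain : FiniteSetoid domain
    rel?          : ∀ R (x : Fin (arity L R) → Carrier) → Dec (rel R x)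

  _≟_ : Decidable _≈_
  _≟_ = inj⇒≟ (Inverse⇒Injection (proj₂ finite-domain))

record FiniteStructure (L : Language) : Set (suc 0ℓ) where
  field
    structure : Structure L
    isFinite  : IsFinite structure

  open Structure structure public
  open IsFinite isFinite public

module _ {L : Language} where

  private
    module S (A : Structure L) = Structure A

  record Hom (A B : Structure L) : Set where
    field
      to        : S.Carrier A → S.Carrier B
      cong      : Congruent (S._≈_ A) (S._≈_ B) to
      preserves : ∀ R x → S.rel A R x → S.rel B R (to ∘ x)

  record IsEmbedding (A B : Structure L) (f : S.Carrier A → S.Carrier B) : Set where
    field
      cong      : Congruent (S._≈_ A) (S._≈_ B) f
      injective : Injective (S._≈_ A) (S._≈_ B) f
      rel⇔      : ∀ R x → S.rel A R x ⇔ S.rel B R (f ∘ x)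

  record Automorphism (A : Structure L) : Set where
    field
      inverse : Inverse (S.domain A) (S.domain A)

    open Inverse inverse public using (to; from)

    field
      rel⇔ : ∀ R x → S.rel A R x ⇔ S.rel A R (to ∘ x)

  Free : List (FiniteStructure L) → Structure L → Set (suc 0ℓ)
  Free 𝒯 M = All (λ T → ¬ Hom (FiniteStructure.structure T) M) 𝒯

module _ {L : Language} (C : FiniteStructure L) where

  open FiniteStructure C

  -- An isomorphism between substructures, given as a partial map and its
  -- partial inverse.  As C is finite, so are the two substructures.
  record PartialIso : Set where
    field
      to from   : Carrier → Maybe Carrier
      to-cong   : ∀ {x y} → x ≈ y → Pointwise _≈_ (to x) (to y)
      from-cong : ∀ {x y} → x ≈ y → Pointwise _≈_ (from x) (from y)

    -- "to x is defined and equals y"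
    _↦_ : Rel Carrier 0ℓ
    x ↦ y = Any (_≈ y) (to x)

    field
      to⇔from : ∀ x y → (x ↦ y) ⇔ Any (_≈ x) (from y)
      rel⇔    : ∀ R {x y : Fin (arity L R) → Carrier} →
                (∀ j → x j ↦ y j) → rel R x ⇔ rel R y

  open PartialIso using () renaming (_↦_ to _⟨_⟩↦_)

  -- "{(a , b)} is a partial isomorphism of C"
  SingletonIso : Carrier → Carrier → Set
  SingletonIso a b =
    Σ[ p ∈ PartialIso ] (∀ x y → (p ⟨ x ⟩↦ y) ⇔ (x ≈ a × y ≈ b))

  RestrictsIdentity : PartialIso → Set
  RestrictsIdentity p = ∀ {x y} → p ⟨ x ⟩↦ y → x ≈ y

  𝒫 : Set
  𝒫 = Σ[ p ∈ PartialIso ] ¬ RestrictsIdentity p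

module _ {L : Language} {C : FiniteStructure L} where

  open FiniteStructure C
  open PartialIso using () renaming (_↦_ to _⟨_⟩↦_)

  infix 4 _at_↦_ _≈𝒫_

  _at_↦_ : 𝒫 C → Carrier → Carrier → Set
  p at x ↦ y = proj₁ p ⟨ x ⟩↦ y

  -- Two partial isomorphisms are equal when their graphs are.
  _≈𝒫_ : Rel (𝒫 C) 0ℓ
  p ≈𝒫 q = ∀ x y → (p at x ↦ y) ⇔ (q at x ↦ y)

  private
    any-resp : ∀ {x y} {m : Maybe Carrier} → x ≈ y → Any (_≈ x) m → Any (_≈ y) m
    any-resp x≈y (just e) = just (trans e x≈y)

    any-pw : ∀ {y} {m m′ : Maybe Carrier} → Pointwise _≈_ m m′ →
             Any (_≈ y) m → Any (_≈ y) m′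
    any-pw (just e) (just e′) = just (trans (sym e) e′)

    any-unique : ∀ {x y} {m : Maybe Carrier} → Any (_≈ x) m → Any (_≈ y) m → x ≈ y
    any-unique (just e) (just e′) = trans (sym e) e′

  at-resp : ∀ (p : 𝒫 C) {x x′ y y′} → x ≈ x′ → y ≈ y′ → p at x ↦ y → p at x′ ↦ y′
  at-resp p e e′ = any-resp e′ ∘ any-pw (PartialIso.to-cong (proj₁ p) e)

  at-unique : ∀ (p : 𝒫 C) {x y y′} → p at x ↦ y → p at x ↦ y′ → y ≈ y′
  at-unique p = any-unique

  infix 8 _⁻¹ᵖ

  _⁻¹ᵖ : 𝒫 C → 𝒫 C
  (p , p∉id) ⁻¹ᵖ = q , λ id → p∉id (λ xy → sym (id (Equivalence.to (to⇔from _ _) xy)))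
    where
    open PartialIso p
    q : PartialIso C
    q = record
      { to        = from
      ; from      = to
      ; to-cong   = from-cong
      ; from-cong = to-cong
      ; to⇔from   = λ x y → mk⇔ (Equivalence.from (to⇔from y x))
                                 (Equivalence.to (to⇔from y x))
      ; rel⇔      = λ R xy →
          let e = rel⇔ R (λ j → Equivalence.from (to⇔from _ _) (xy j))
          in mk⇔ (Equivalence.from e) (Equivalence.to e)
      }

  at-⁻¹ᵖ : ∀ (p : 𝒫 C) {x y} → (p at x ↦ y) ⇔ (p ⁻¹ᵖ at y ↦ x)
  at-⁻¹ᵖ p = PartialIso.to⇔from (proj₁ p) _ _

𝒫-setoid : {L : Language} → FiniteStructure L → Setoid 0ℓ 0ℓ
𝒫-setoid C = record
  { Carrier = 𝒫 C
  ; _≈_ = _≈𝒫_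
  ; isEquivalence = record
    { refl  = λ x y → mk⇔ (λ z → z) (λ z → z)
    ; sym   = λ e x y → mk⇔ (Equivalence.from (e x y)) (Equivalence.to (e x y))
    ; trans = λ e f x y → mk⇔ (Equivalence.to (f x y) ∘ Equivalence.to (e x y))
                              (Equivalence.from (e x y) ∘ Equivalence.from (f x y))
    }
  }

-- ι is the embedding through which D is regarded as an extension of C.
record IsHLExtension {L : Language} (C : FiniteStructure L) (D : Structure L)
    (ι : FiniteStructure.Carrier C → Structure.Carrier D)
    (φ : 𝒫 C → Automorphism D) : Set where
  open Structure D using (_≈_)
  open Automorphism using (to; from)
  field
    isEmbedding : IsEmbedding (FiniteStructure.structure C) D ι
    φ-cong      : ∀ {p q} → p ≈𝒫 q → ∀ d → to (φ p) d ≈ to (φ q) d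
    φ-extends   : ∀ p {a b} → p at a ↦ b → to (φ p) (ι a) ≈ ι b
    φ-⁻¹        : ∀ p d → to (φ (p ⁻¹ᵖ)) d ≈ from (φ p) d

record HLExtension {L : Language} (C : FiniteStructure L) : Set (suc 0ℓ) where
  field
    structure     : Structure L
    ι             : FiniteStructure.Carrier C → Structure.Carrier structure
    φ             : 𝒫 C → Automorphism structure
    isHLExtension : IsHLExtension C structure ι φ

  open Structure structure public

module _ {L : Language} {C : FiniteStructure L} where

  open Automorphism using (to)

  Minimal : HLExtension C → Set
  Minimal D = ∀ b → ¬ (∃[ c ] ι c ≈ b) →
    Σ[ ps ∈ List (𝒫 C) ] ∃[ a ] b ≈ foldr (to ∘ φ) (ι a) ps
    where open HLExtension D

  record HLHom (D₁ D₂ : HLExtension C) : Set where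
    private
      module D₁ = HLExtension D₁
      module D₂ = HLExtension D₂
    field
      hom : Hom D₁.structure D₂.structure

    open Hom hom renaming (to to ψ) public

    field
      fixes-C  : ∀ c → ψ (D₁.ι c) D₂.≈ D₂.ι c
      commutes : ∀ p d → ψ (to (D₁.φ p) d) D₂.≈ to (D₂.φ p) (ψ d)

module _ {L : Language} (C : FiniteStructure L) where

  open FiniteStructure C

  Homogeneous : Pred Carrier 0ℓ → Set
  Homogeneous S = ∀ {a b} → S a → S b → SingletonIso C a b

  -- The parts are the fibres of `class`.
  record NaturalFactorization : Set (suc 0ℓ) where
    field
      n          : ℕ
      class      : Carrier → Fin n
      class-cong : Congruent _≈_ _≡_ class

    Part : Fin n → Pred Carrier 0ℓ
    Part i a = class a ≡ i

    field
      homogeneous : ∀ i → Homogeneous (Part i)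
      maximal     : ∀ i (S : Pred Carrier 0ℓ) → Homogeneous S →
                    (∀ {a} → Part i a → S a) → ∀ {a} → S a → Part i a
      point       : Fin n → Carrier
      point∈      : ∀ i → Part i (point i)

module _ (G : Group 0ℓ 0ℓ) where

  open Group G

  record IsSubgroup (P : Pred Carrier 0ℓ) : Set where
    field
      resp      : ∀ {x y} → x ≈ y → P x → P y
      ε-closed  : P ε
      ∙-closed  : ∀ {x y} → P x → P y → P (x ∙ y)
      ⁻¹-closed : ∀ {x} → P x → P (x ⁻¹)

  leftCosets : (P : Pred Carrier 0ℓ) → IsSubgroup P → Setoid 0ℓ 0ℓ
  leftCosets P isSub = record
    { Carrier = Carrier
    ; _≈_ = λ g h → P (g ⁻¹ ∙ h)
    ; isEquivalence = record
      { refl  = λ {g} → resp (Group.sym G (inverseˡ g)) ε-closed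
      ; sym   = λ {g} {h} → resp (sym-eq g h) ∘ ⁻¹-closed
      ; trans = λ {g} {h} {k} p q → resp (trans-eq g h k) (∙-closed p q)
      }
    }
    where
    open IsSubgroup isSub
    open GroupProperties G
    open SetoidReasoning setoid
    sym-eq : ∀ g h → (g ⁻¹ ∙ h) ⁻¹ ≈ h ⁻¹ ∙ g
    sym-eq g h = begin
      (g ⁻¹ ∙ h) ⁻¹     ≈⟨ ⁻¹-anti-homo-∙ (g ⁻¹) h ⟩
      h ⁻¹ ∙ g ⁻¹ ⁻¹    ≈⟨ ∙-congˡ (⁻¹-involutive g) ⟩
      h ⁻¹ ∙ g          ∎
    trans-eq : ∀ g h k → (g ⁻¹ ∙ h) ∙ (h ⁻¹ ∙ k) ≈ g ⁻¹ ∙ k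
    trans-eq g h k = begin
      (g ⁻¹ ∙ h) ∙ (h ⁻¹ ∙ k)  ≈⟨ assoc (g ⁻¹) h (h ⁻¹ ∙ k) ⟩
      g ⁻¹ ∙ (h ∙ (h ⁻¹ ∙ k))  ≈⟨ ∙-congˡ (\\-leftDividesˡ h k) ⟩
      g ⁻¹ ∙ k                 ∎

  record FiniteIndexNormalSubgroup : Set (suc 0ℓ) where
    field
      member      : Pred Carrier 0ℓ
      isSubgroup  : IsSubgroup member
      conj-closed : ∀ g {x} → member x → member (g ∙ x ∙ g ⁻¹)
      finiteIndex : FiniteSetoid (leftCosets member isSubgroup)

  module _ (N : FiniteIndexNormalSubgroup) {H : Pred Carrier 0ℓ} (H≤ : IsSubgroup H) where

    private
      module N where
        open FiniteIndexNormalSubgroup N public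
        open IsSubgroup isSubgroup public
      module H = IsSubgroup H≤
    open GroupProperties G
    open SetoidReasoning setoid

    productSet : Pred Carrier 0ℓ
    productSet g = ∃[ x ] ∃[ h ] N.member x × H h × g ≈ x ∙ h

    private
      mul-eq : ∀ x h y k → (x ∙ h) ∙ (y ∙ k) ≈ (x ∙ (h ∙ y ∙ h ⁻¹)) ∙ (h ∙ k)
      mul-eq x h y k = begin
        (x ∙ h) ∙ (y ∙ k)                    ≈⟨ assoc x h (y ∙ k) ⟩
        x ∙ (h ∙ (y ∙ k))                    ≈⟨ ∙-congˡ (assoc h y k) ⟨
        x ∙ (h ∙ y ∙ k)                      ≈⟨ ∙-congˡ (∙-congˡ (\\-leftDividesʳ h k)) ⟨
        x ∙ (h ∙ y ∙ (h ⁻¹ ∙ (h ∙ k)))       ≈⟨ ∙-congˡ (assoc (h ∙ y) (h ⁻¹) (h ∙ k)) ⟨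
        x ∙ (h ∙ y ∙ h ⁻¹ ∙ (h ∙ k))         ≈⟨ assoc x (h ∙ y ∙ h ⁻¹) (h ∙ k) ⟨
        (x ∙ (h ∙ y ∙ h ⁻¹)) ∙ (h ∙ k)       ∎

      inv-eq : ∀ x h → (x ∙ h) ⁻¹ ≈ (h ⁻¹ ∙ x ⁻¹ ∙ h ⁻¹ ⁻¹) ∙ h ⁻¹
      inv-eq x h = begin
        (x ∙ h) ⁻¹                           ≈⟨ ⁻¹-anti-homo-∙ x h ⟩
        h ⁻¹ ∙ x ⁻¹                          ≈⟨ //-rightDividesʳ (h ⁻¹) (h ⁻¹ ∙ x ⁻¹) ⟨
        h ⁻¹ ∙ x ⁻¹ ∙ h ⁻¹ ∙ h ⁻¹ ⁻¹         ≈⟨ assoc _ _ _ ⟩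
        h ⁻¹ ∙ x ⁻¹ ∙ (h ⁻¹ ∙ h ⁻¹ ⁻¹)       ≈⟨ ∙-congˡ (trans (inverseʳ _) (sym (inverseˡ _))) ⟩
        h ⁻¹ ∙ x ⁻¹ ∙ (h ⁻¹ ⁻¹ ∙ h ⁻¹)       ≈⟨ assoc _ _ _ ⟨
        (h ⁻¹ ∙ x ⁻¹ ∙ h ⁻¹ ⁻¹) ∙ h ⁻¹       ∎

    productSubgroup : IsSubgroup productSet
    productSubgroup = record
      { resp      = λ { e (x , h , nx , hh , e′) → x , h , nx , hh , trans (sym e) e′ }
      ; ε-closed  = ε , ε , N.ε-closed , H.ε-closed , sym (identityˡ ε)
      ; ∙-closed  = λ { (x , h , nx , hh , e) (y , k , ny , hk , e′) →
          _ , _ , N.∙-closed nx (N.conj-closed h ny) , H.∙-closed hh hk ,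
          trans (∙-cong e e′) (mul-eq x h y k) }
      ; ⁻¹-closed = λ { (x , h , nx , hh , e) →
          _ , _ , N.conj-closed (h ⁻¹) (N.⁻¹-closed nx) , H.⁻¹-closed hh ,
          trans (⁻¹-cong e) (inv-eq x h) }
      }

module _ {L : Language} (C : FiniteStructure L) where

  open FiniteStructure C

  Word : Set
  Word = List (𝒫 C)

module _ {L : Language} {C : FiniteStructure L} where

  open FiniteStructure C

  infix 4 _∼_ _acts_↦_

  -- Equality in the free group on 𝒫 C where the group inverse of p is the
  -- partial isomorphism p⁻¹.  As the generators are closed under inverse,
  -- words in them represent all group elements.
  data _∼_ : Rel (Word C) 0ℓ where
    ∼-refl  : ∀ {u} → u ∼ u
    ∼-sym   : ∀ {u v} → u ∼ v → v ∼ u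
    ∼-trans : ∀ {u v w} → u ∼ v → v ∼ w → u ∼ w
    ++-cong : ∀ {u u′ v v′} → u ∼ u′ → v ∼ v′ → u ++ v ∼ u′ ++ v′
    letter  : ∀ {p q} → p ≈𝒫 q → [ p ] ∼ [ q ]
    cancel  : ∀ p → p ∷ p ⁻¹ᵖ ∷ [] ∼ []

  invert : Word C → Word C
  invert []       = []
  invert (p ∷ w) = invert w ++ [ p ⁻¹ᵖ ]

  private
    ≡⇒∼ : ∀ {u v} → u ≡ v → u ∼ v
    ≡⇒∼ ≡.refl = ∼-refl

    cancel′ : ∀ p → p ⁻¹ᵖ ∷ p ∷ [] ∼ []
    cancel′ p = ∼-trans
      (++-cong (∼-refl {[ p ⁻¹ᵖ ]})
               (letter {p} {p ⁻¹ᵖ ⁻¹ᵖ} (λ _ _ → mk⇔ (λ z → z) (λ z → z))))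
      (cancel (p ⁻¹ᵖ))

    invert-++ : ∀ u v → invert (u ++ v) ≡ invert v ++ invert u
    invert-++ []      v = ≡.sym (++-identityʳ (invert v))
    invert-++ (p ∷ u) v = ≡.trans (≡.cong (_++ [ p ⁻¹ᵖ ]) (invert-++ u v))
                                  (++-assoc (invert v) (invert u) [ p ⁻¹ᵖ ])

    ⁻¹ᵖ-cong : ∀ {p q : 𝒫 C} → p ≈𝒫 q → p ⁻¹ᵖ ≈𝒫 q ⁻¹ᵖ
    ⁻¹ᵖ-cong {p} {q} e x y = mk⇔
      (Equivalence.to (at-⁻¹ᵖ q) ∘ Equivalence.to (e y x) ∘ Equivalence.from (at-⁻¹ᵖ p))
      (Equivalence.to (at-⁻¹ᵖ p) ∘ Equivalence.from (e y x) ∘ Equivalence.from (at-⁻¹ᵖ q))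

    invert-cong : ∀ {u v} → u ∼ v → invert u ∼ invert v
    invert-cong ∼-refl        = ∼-refl
    invert-cong (∼-sym e)     = ∼-sym (invert-cong e)
    invert-cong (∼-trans e f) = ∼-trans (invert-cong e) (invert-cong f)
    invert-cong (++-cong {u} {u′} {v} {v′} e f) =
      ∼-trans (≡⇒∼ (invert-++ u v))
        (∼-trans (++-cong (invert-cong f) (invert-cong e))
                 (≡⇒∼ (≡.sym (invert-++ u′ v′))))
    invert-cong (letter {p} {q} e) = letter (⁻¹ᵖ-cong {p} {q} e)
    invert-cong (cancel p)    = cancel′ (p ⁻¹ᵖ)

    inverseʳ : ∀ w → w ++ invert w ∼ []
    inverseʳ []      = ∼-refl
    inverseʳ (p ∷ w) =
      ∼-trans (++-cong (∼-refl {[ p ]})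
        (∼-trans (≡⇒∼ (≡.sym (++-assoc w (invert w) [ p ⁻¹ᵖ ])))
                 (++-cong (inverseʳ w) (∼-refl {[ p ⁻¹ᵖ ]}))))
        (cancel p)

    inverseˡ : ∀ w → invert w ++ w ∼ []
    inverseˡ []      = ∼-refl
    inverseˡ (p ∷ w) =
      ∼-trans (≡⇒∼ (++-assoc (invert w) [ p ⁻¹ᵖ ] (p ∷ w)))
      (∼-trans (++-cong (∼-refl {invert w}) (++-cong (cancel′ p) (∼-refl {w})))
               (inverseˡ w))

  -- "p₁(⋯(pₘ(a))⋯) is defined and equals b"
  _acts_↦_ : Word C → Carrier → Carrier → Set
  []      acts a ↦ b = a ≈ b
  (p ∷ w) acts a ↦ b = ∃[ c ] w acts a ↦ c × p at c ↦ b

  private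
    acts-respʳ : ∀ w {a b b′} → b ≈ b′ → w acts a ↦ b → w acts a ↦ b′
    acts-respʳ []      e ab           = trans ab e
    acts-respʳ (p ∷ w) e (c , ac , cb) = c , ac , at-resp p refl e cb

    acts-respˡ : ∀ w {a a′ b} → a ≈ a′ → w acts a ↦ b → w acts a′ ↦ b
    acts-respˡ []      e ab            = trans (sym e) ab
    acts-respˡ (p ∷ w) e (c , ac , cb) = c , acts-respˡ w e ac , cb

  acts-++ : ∀ u {v a b c} → v acts a ↦ b → u acts b ↦ c → u ++ v acts a ↦ c
  acts-++ []      {v} va e             = acts-respʳ v e va
  acts-++ (p ∷ u) va (d , ud , pd) = d , acts-++ u va ud , pd

  acts-invert : ∀ w {a b} → w acts a ↦ b → invert w acts b ↦ a
  acts-invert []      ab            = sym ab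
  acts-invert (p ∷ w) (c , ac , cb) =
    acts-++ (invert w) (_ , refl , Equivalence.to (at-⁻¹ᵖ p) cb) (acts-invert w ac)

  freeGroup : Group 0ℓ 0ℓ
  freeGroup = record
    { Carrier = Word C
    ; _≈_ = _∼_
    ; _∙_ = _++_
    ; ε = []
    ; _⁻¹ = invert
    ; isGroup = record
      { isMonoid = record
        { isSemigroup = record
          { isMagma = record
            { isEquivalence = record { refl = ∼-refl ; sym = ∼-sym ; trans = ∼-trans }
            ; ∙-cong = ++-cong
            }
          ; assoc = λ u v w → ≡⇒∼ (++-assoc u v w)
          }
        ; identity = (λ _ → ∼-refl) , (λ u → ≡⇒∼ (++-identityʳ u))
        }
      ; inverse = inverseˡ , inverseʳ
      ; ⁻¹-cong = invert-cong
      }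
    }

𝔽 : {L : Language} → FiniteStructure L → Group 0ℓ 0ℓ
𝔽 C = freeGroup {C = C}

-- g(a) = a for a group element g: some word representing g is defined at
-- a and fixes it.  (Cancelling p p⁻¹ in a word only enlarges its domain,
-- so equivalently the reduced word for g is defined at a and fixes it.)
Stabilizer : {L : Language} (C : FiniteStructure L) →
             FiniteStructure.Carrier C → Pred (Word C) 0ℓ
Stabilizer C a g = ∃[ w ] w ∼ g × w acts a ↦ a

stabilizerSubgroup : {L : Language} (C : FiniteStructure L) →
                     (a : FiniteStructure.Carrier C) →
                     IsSubgroup (𝔽 C) (Stabilizer C a)
stabilizerSubgroup C a = record
  { resp      = λ { e (w , we , wa) → w , ∼-trans we e , wa }
  ; ε-closed  = [] , ∼-refl , FiniteStructure.refl C
  ; ∙-closed  = λ { (u , ue , ua) (v , ve , va) →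
                    u ++ v , ++-cong ue ve , acts-++ u va ua }
  ; ⁻¹-closed = λ { (w , we , wa) →
                    invert w , Group.⁻¹-cong (𝔽 C) we , acts-invert w wa }
  }

module Construction {L : Language} (C : FiniteStructure L)
    (F : NaturalFactorization C)
    (N : Fin (NaturalFactorization.n F) → FiniteIndexNormalSubgroup (𝔽 C)) where

  private
    module C = FiniteStructure C
    module G = Group (𝔽 C)
  open NaturalFactorization F

  NH : Fin n → Pred (Word C) 0ℓ
  NH i = productSet (𝔽 C) (N i) (stabilizerSubgroup C (point i))

  NH≤ : ∀ i → IsSubgroup (𝔽 C) (NH i)
  NH≤ i = productSubgroup (𝔽 C) (N i) (stabilizerSubgroup C (point i))

  private
    module Cosets (i : Fin n) = Setoid (leftCosets (𝔽 C) (NH i) (NH≤ i))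

  -- (i , g) stands for the coset g Nᵢ Hᵢ.
  infix 4 _≈Γ_
  data _≈Γ_ : Rel (Fin n × Word C) 0ℓ where
    coset : ∀ {i g h} → Cosets._≈_ i g h → (i , g) ≈Γ (i , h)

  private
    Γ-trans : ∀ {x y z} → x ≈Γ y → y ≈Γ z → x ≈Γ z
    Γ-trans (coset {i} {g} {h} e) (coset {h = k} f) = coset (Cosets.trans i {g} {h} {k} e f)

    Γ-sym : ∀ {x y} → x ≈Γ y → y ≈Γ x
    Γ-sym (coset {i} {g} {h} e) = coset (Cosets.sym i {g} {h} e)

    Γ-refl : ∀ {x} → x ≈Γ x
    Γ-refl {i , g} = coset (Cosets.refl i {g})

  -- 𝒫 C together with 1_C.  The relations of Γ must admit pⱼ = 1_C, just as
  -- π treats the chosen points separately: if C is a single point a with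
  -- R(a), then 𝒫 C is empty, so with pⱼ ∈ 𝒫 C only, R would be empty in Γ
  -- and π would not be an embedding.
  𝒫₁ : Set
  𝒫₁ = Maybe (𝒫 C)

  _at₁_↦_ : 𝒫₁ → C.Carrier → C.Carrier → Set
  just p  at₁ a ↦ b = p at a ↦ b
  nothing at₁ a ↦ b = a C.≈ b

  word₁ : 𝒫₁ → Word C
  word₁ = maybe′ [_] []

  record RelΓ (R : Symbol L) (x : Fin (arity L R) → Fin n × Word C) : Set where
    field
      i     : Fin (arity L R) → Fin n
      p     : Fin (arity L R) → 𝒫₁
      g     : Word C
      c     : Fin (arity L R) → C.Carrier
      p-at  : ∀ j → p j at₁ point (i j) ↦ c j
      x≈    : ∀ j → x j ≈Γ (i j , g ++ word₁ (p j))
      holds : C.rel R c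

  Γ : Structure L
  Γ = record
    { domain = record
      { Carrier = Fin n × Word C
      ; _≈_ = _≈Γ_
      ; isEquivalence = record { refl = Γ-refl ; sym = Γ-sym ; trans = Γ-trans }
      }
    ; rel = RelΓ
    ; rel-resp = λ R e r → record
      { RelΓ r
      ; x≈ = λ j → Γ-trans (Γ-sym (e j)) (RelΓ.x≈ r j)
      }
    }

  translate : Word C → Fin n × Word C → Fin n × Word C
  translate w (i , g) = i , w ++ g

  private
    ∼⇒≈Γ : ∀ {i g h} → g ∼ h → (i , g) ≈Γ (i , h)
    ∼⇒≈Γ {i} {g} {h} e = coset (IsSubgroup.resp (NH≤ i)
      (G.trans (G.sym (G.inverseˡ g)) (G.∙-congˡ {invert g} e))
      (IsSubgroup.ε-closed (NH≤ i)))

    translate-cong : ∀ w {x y} → x ≈Γ y → translate w x ≈Γ translate w y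
    translate-cong w (coset {i} {g} {h} e) = coset (IsSubgroup.resp (NH≤ i) (G.sym eq) e)
      where
      open SetoidReasoning G.setoid
      open GroupProperties (𝔽 C)
      eq : invert (w ++ g) ++ (w ++ h) ∼ invert g ++ h
      eq = begin
        invert (w ++ g) ++ (w ++ h)         ≈⟨ G.∙-congʳ {w ++ h} (⁻¹-anti-homo-∙ w g) ⟩
        (invert g ++ invert w) ++ (w ++ h)  ≈⟨ G.assoc (invert g) (invert w) (w ++ h) ⟩
        invert g ++ (invert w ++ (w ++ h))  ≈⟨ G.∙-congˡ {invert g} (\\-leftDividesʳ w h) ⟩
        invert g ++ h                       ∎

    translate-rel : ∀ w R x → RelΓ R x → RelΓ R (translate w ∘ x)
    translate-rel w R x r = record
      { RelΓ r
      ; g  = w ++ g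
      ; x≈ = λ j → Γ-trans (translate-cong w (x≈ j))
               (∼⇒≈Γ (G.sym (G.assoc w g (word₁ (p j)))))
      }
      where open RelΓ r

    translate-inv : ∀ u v → u ++ v ∼ [] → ∀ x → translate u (translate v x) ≈Γ x
    translate-inv u v e (i , g) =
      ∼⇒≈Γ (G.trans (G.sym (G.assoc u v g)) (G.∙-congʳ {g} e))

  Φ : 𝒫 C → Automorphism Γ
  Φ p = record
    { inverse = record
      { to        = translate [ p ]
      ; from      = translate [ p ⁻¹ᵖ ]
      ; to-cong   = translate-cong [ p ]
      ; from-cong = translate-cong [ p ⁻¹ᵖ ]
      ; inverse   = (λ {x} e → Γ-trans (translate-cong [ p ] e) (pp⁻¹ x))
                  , (λ {x} e → Γ-trans (translate-cong [ p ⁻¹ᵖ ] e) (p⁻¹p x))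
      }
    ; rel⇔ = λ R x → mk⇔ (translate-rel [ p ] R x)
        (λ r → Structure.rel-resp Γ R (p⁻¹p ∘ x) (translate-rel [ p ⁻¹ᵖ ] R _ r))
    }
    where
    pp⁻¹ : ∀ x → translate [ p ] (translate [ p ⁻¹ᵖ ] x) ≈Γ x
    pp⁻¹ = translate-inv [ p ] [ p ⁻¹ᵖ ] (G.inverseʳ [ p ])
    p⁻¹p : ∀ x → translate [ p ⁻¹ᵖ ] (translate [ p ] x) ≈Γ x
    p⁻¹p = translate-inv [ p ⁻¹ᵖ ] [ p ] (G.inverseˡ [ p ])

  private
    moving : ∀ a → ¬ (a C.≈ point (class a)) →
             Σ[ p ∈ 𝒫 C ] p at point (class a) ↦ a
    moving a a≉ with homogeneous (class a) (point∈ (class a)) ≡.refl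
    ... | p , graph = (p , λ id → a≉ (C.sym (id here))) , here
      where here = Equivalence.from (graph (point (class a)) a) (C.refl , C.refl)

    same-coset : ∀ {i a} (q p : 𝒫 C) → q at point i ↦ a → p at point i ↦ a →
                 (i , [ q ]) ≈Γ (i , [ p ])
    same-coset {i} {a} q p qa pa = coset
      ( [] , q ⁻¹ᵖ ∷ p ∷ []
      , IsSubgroup.ε-closed (FiniteIndexNormalSubgroup.isSubgroup (N i))
      , ( q ⁻¹ᵖ ∷ p ∷ [] , ∼-refl
        , a , (point i , C.refl , pa) , Equivalence.to (at-⁻¹ᵖ q) qa )
      , ∼-refl )

  -- For a ≉ aᵢ the member of 𝒫 C taking aᵢ to a is {(aᵢ , a)}; by π-moved
  -- any other one gives the same coset.
  π : C.Carrier → Fin n × Word C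
  π a with a C.≟ point (class a)
  ... | yes _ = class a , []
  ... | no a≉ = class a , [ proj₁ (moving a a≉) ]

  π-point : ∀ a → a C.≈ point (class a) → π a ≈Γ (class a , [])
  π-point a a≈ with a C.≟ point (class a)
  ... | yes _ = Γ-refl
  ... | no a≉ = contradiction a≈ a≉

  π-moved : ∀ a → ¬ (a C.≈ point (class a)) →
            ∀ (p : 𝒫 C) → p at point (class a) ↦ a → π a ≈Γ (class a , [ p ])
  π-moved a a≉ p pa with a C.≟ point (class a)
  ... | yes a≈ = contradiction a≈ a≉
  ... | no a≉′ = same-coset (proj₁ (moving a a≉′)) p (proj₂ (moving a a≉′)) pa

  Γ-extension : IsHLExtension C Γ π Φ → HLExtension C
  Γ-extension isHL = record { structure = Γ ; ι = π ; φ = Φ ; isHLExtension = isHL }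

open Construction public using (Γ; Φ; π; Γ-extension)

{-# OPTIONS --safe #-}

-- Take every Nᵢ to be the kernel K of the action of 𝔽 C on D.  Then
-- gKHᵢ ↦ g(aᵢ) is a well-defined homomorphism Γ → D over C.  Because it is
-- the identity on C, π is an embedding; because it is a homomorphism, Γ is
-- 𝒯-free; and minimality of D makes it onto.
--
-- Finiteness has to be effective.  Words act on D through finitely many
-- value tables, so 𝔽 C / K is enumerated by deciding which tables are
-- reachable.  A word g lies in KHᵢ iff some word w defined at aᵢ and fixing
-- it acts on D as g; this asks whether the intersection of two regular
-- languages is nonempty.
module Submission where

open import Defs
open import Algebra.Bundles using (Group)
import Algebra.Properties.Group as GroupProperties
open import Data.Fin.Base using (Fin; zero; suc; finToFun; funToFin)
import Data.Fin.Properties as Fin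
open import Data.List.Base
  using (List; []; _∷_; _++_; [_]; foldr; map; allFin; cartesianProduct; deduplicate; lookup)
open import Data.List.Membership.Propositional using (_∈_)
open import Data.List.Membership.Propositional.Properties using (∈-allFin; ∈-lookup; ∈-cartesianProduct⁺)
import Data.List.Membership.Setoid as Membership
import Data.List.Membership.Setoid.Properties as ∈
open import Data.List.Properties using (foldr-++; ++-identityʳ)
import Data.List.Relation.Unary.All as All
open import Data.List.Relation.Unary.AllPairs using (_∷_)
open import Data.List.Relation.Unary.Any as Any using (Any; here; there; any?)
open import Data.List.Relation.Unary.Any.Properties using (lookup-index)
open import Data.List.Relation.Unary.Enumerates.Setoid using (IsEnumeration)
import Data.List.Relation.Unary.Enumerates.Setoid.Properties as Enumerates
open import Data.List.Relation.Unary.Unique.DecSetoid.Properties using (deduplicate-!)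
import Data.List.Relation.Unary.Unique.Setoid as Unique
open import Data.Maybe.Base using (Maybe; just; nothing)
import Data.Maybe.Relation.Binary.Pointwise as Pointwise
open Pointwise using (Pointwise; just; nothing)
import Data.Maybe.Relation.Unary.Any as MaybeAny
open import Data.Nat.Base using (_^_)
open import Data.Product.Base using (Σ-syntax; ∃; ∃-syntax; _×_; _,_; proj₁; proj₂; swap; uncurry)
open import Data.Product.Properties using (≡-dec)
open import Data.Product.Relation.Binary.Pointwise.NonDependent using (_×ₛ_)
open import Data.Sum.Base using (_⊎_; inj₁; inj₂; [_,_]′)
import Data.Vec.Functional.Relation.Binary.Equality.Setoid as Tuple
open import Function.Base using (_∘_; id; const)
open import Function.Bundles using (Inverse; Equivalence; _⇔_; mk⇔)
open import Function.Construct.Identity using () renaming (inverse to id-inverse)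
open import Function.Definitions using (Congruent; Surjective)
open import Level using (0ℓ)
open import Relation.Binary.Bundles using (Setoid)
open import Relation.Binary.Core using (Rel)
open import Relation.Binary.Definitions using (Decidable; DecidableEquality; _Respects_)
open import Relation.Binary.PropositionalEquality as ≡ using (_≡_)
import Relation.Binary.Reasoning.Setoid as SetoidReasoning
open import Relation.Nullary.Decidable using (Dec; yes; no; map′; ¬?; _×-dec_; _⊎-dec_; _→-dec_)
open import Relation.Nullary.Negation using (¬_; contradiction)
import Relation.Unary as Unary

open Equivalence using () renaming (to to ⇒; from to ⇐)

-- Searching enumerable setoids, and finite setoids with their value tables.

infixr 2 _⇔-dec_

_⇔-dec_ : {A B : Set} → Dec A → Dec B → Dec (A ⇔ B)
a? ⇔-dec b? = map′ (uncurry mk⇔) (λ e → ⇒ e , ⇐ e) ((a? →-dec b?) ×-dec (b? →-dec a?))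

record Enumerable (S : Setoid 0ℓ 0ℓ) : Set where
  constructor _,_
  field
    elements    : List (Setoid.Carrier S)
    enumeration : IsEnumeration S elements

module _ {S : Setoid 0ℓ 0ℓ} where

  open Setoid S
  open Unique S using (Unique)

  module _ (S-enumerable : Enumerable S) {P : Carrier → Set} (resp : P Respects _≈_)
      (P? : Unary.Decidable P) where

    open Enumerable S-enumerable renaming (elements to xs; enumeration to ∈xs)

    ∃? : Dec (∃ P)
    ∃? = map′ Any.satisfied (λ (x , px) → Membership.lose S resp (∈xs x) px) (any? P? xs)

    ∀? : Dec (∀ x → P x)
    ∀? = map′ (λ ps x → All.lookupₛ S resp ps (∈xs x)) (λ ps → All.universal ps xs)
              (All.all? P? xs)

  lookup-injective : ∀ {xs} → Unique xs → ∀ i j → lookup xs i ≈ lookup xs j → i ≡ j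
  lookup-injective (_ ∷ _)   zero    zero    _ = ≡.refl
  lookup-injective (x∉ ∷ _)  zero    (suc j) e = contradiction e (All.lookup x∉ (∈-lookup j))
  lookup-injective (x∉ ∷ _)  (suc i) zero    e = contradiction (sym e) (All.lookup x∉ (∈-lookup i))
  lookup-injective (_ ∷ xs!) (suc i) (suc j) e = ≡.cong suc (lookup-injective xs! i j e)

  enumerable⇒finite : Decidable _≈_ → Enumerable S → FiniteSetoid S
  enumerable⇒finite _≟_ (xs , ∈xs) = _ , record
    { to        = position
    ; from      = lookup ys
    ; to-cong   = λ e → lookup-injective ys! _ _
                    (trans (trans (sym (at-position _)) e) (at-position _))
    ; from-cong = reflexive ∘ ≡.cong (lookup ys)
    ; inverse   = (λ e → lookup-injective ys! _ _ (trans (sym (at-position _)) e))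
                , (λ { ≡.refl → sym (at-position _) })
    }
    where
    decSetoid = record { isDecEquivalence = record { isEquivalence = isEquivalence ; _≟_ = _≟_ } }
    ys = deduplicate _≟_ xs
    ys! = deduplicate-! decSetoid xs
    ∈ys : IsEnumeration S ys
    ∈ys = Enumerates.deduplicate⁺ decSetoid ∈xs
    position : Carrier → Fin _
    position = Any.index ∘ ∈ys
    at-position : ∀ x → x ≈ lookup ys (position x)
    at-position = lookup-index ∘ ∈ys

module Finite {S : Setoid 0ℓ 0ℓ} (fin : FiniteSetoid S) where

  open Setoid S

  size = proj₁ fin
  open Inverse (proj₂ fin) public
    renaming (to to encode; from to decode; to-cong to encode-cong)

  decode-encode : ∀ x → decode (encode x) ≈ x
  decode-encode = strictlyInverseʳ

  enumerable : Enumerable S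
  enumerable = map decode (allFin size) , λ x →
    ∈.∈-resp-≈ S (decode-encode x)
      (∈.∈-map⁺ (≡.setoid _) S (λ { ≡.refl → refl }) (∈-allFin (encode x)))

  _≟ᶠ_ : Decidable _≈_
  x ≟ᶠ y = map′
    (λ e → trans (sym (decode-encode x)) (trans (reflexive (≡.cong decode e)) (decode-encode y)))
    encode-cong (encode x Fin.≟ encode y)

Fin-finite : ∀ n → FiniteSetoid (≡.setoid (Fin n))
Fin-finite n = n , id-inverse _

×-enumerable : {S T : Setoid 0ℓ 0ℓ} → Enumerable S → Enumerable T → Enumerable (S ×ₛ T)
×-enumerable {S} {T} (_ , ∈xs) (_ , ∈ys) = _ , Enumerates.cartesianProduct⁺ S T ∈xs ∈ys

Maybe-finite : {S : Setoid 0ℓ 0ℓ} → FiniteSetoid S → FiniteSetoid (Pointwise.setoid S)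
Maybe-finite {S} fin = enumerable⇒finite (Pointwise.dec _≟ᶠ_) (nothing ∷ map just xs , λ where
    nothing  → here nothing
    (just x) → there (∈.∈-map⁺ S (Pointwise.setoid S) just (∈xs x)))
  where
  open Finite fin
  xs = Enumerable.elements enumerable
  ∈xs = Enumerable.enumeration enumerable

-- Maps between finite setoids are encoded by their value tables, since
-- without function extensionality a function type is not finite for _≡_.
module Tables {S T : Setoid 0ℓ 0ℓ} (finS : FiniteSetoid S) (finT : FiniteSetoid T) where

  private
    module S where
      open Setoid S public
      open Finite finS public
    module T where
      open Setoid T public
      open Finite finT public

  Table : Set
  Table = Fin (T.size ^ S.size)

  ⟨_⟩ : Table → S.Carrier → T.Carrier
  ⟨ t ⟩ x = T.decode (finToFun t (S.encode x))

  ⟨⟩-cong : ∀ t → Congruent S._≈_ T._≈_ ⟨ t ⟩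
  ⟨⟩-cong t e = T.reflexive (≡.cong (T.decode ∘ finToFun t) (S.encode-cong e))

  table : (S.Carrier → T.Carrier) → Table
  table f = funToFin (T.encode ∘ f ∘ S.decode)

  ⟨table⟩ : ∀ {f} → Congruent S._≈_ T._≈_ f → ∀ x → ⟨ table f ⟩ x T.≈ f x
  ⟨table⟩ {f} f-cong x = T.trans
    (T.reflexive (≡.cong T.decode (Fin.finToFun-funToFin _ (S.encode x))))
    (T.trans (T.decode-encode _) (f-cong (S.decode-encode x)))

Tuples-enumerable : {S : Setoid 0ℓ 0ℓ} → FiniteSetoid S → ∀ n → Enumerable (Tuple.≋-setoid S n)
Tuples-enumerable {S} fin n = map ⟨_⟩ (allFin _) , λ f →
  ∈.∈-resp-≈ (Tuple.≋-setoid S n) (⟨table⟩ (λ { ≡.refl → Setoid.refl S }))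
    (∈.∈-map⁺ (≡.setoid _) (Tuple.≋-setoid S n)
      (λ { ≡.refl _ → Setoid.refl S }) (∈-allFin (table f)))
  where open Tables (Fin-finite n) fin

module _ {S : Setoid 0ℓ 0ℓ} {Code : Set} (codes : List Code) (∈codes : ∀ c → c ∈ codes)
    (_encodedBy_ : Setoid.Carrier S → Code → Set)
    (used? : ∀ c → Dec (∃[ x ] x encodedBy c))
    (code : ∀ x → ∃[ c ] x encodedBy c)
    (determined : ∀ {x y c} → x encodedBy c → y encodedBy c → Setoid._≈_ S x y)
  where

  open Membership S using () renaming (_∈_ to _∈ₛ_)

  private
    decoded : List Code → List (Setoid.Carrier S)
    decoded []       = []
    decoded (c ∷ cs) with used? c
    ... | yes (x , _) = x ∷ decoded cs
    ... | no _        = decoded cs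

    ∈-decoded : ∀ {c cs x} → c ∈ cs → x encodedBy c → x ∈ₛ decoded cs
    ∈-decoded {cs = c ∷ cs} c∈ xc with used? c | c∈
    ... | yes (y , yc) | here ≡.refl = here (determined xc yc)
    ... | yes _        | there c∈cs  = there (∈-decoded c∈cs xc)
    ... | no unused    | here ≡.refl = contradiction (_ , xc) unused
    ... | no _         | there c∈cs  = ∈-decoded c∈cs xc

  -- Listing codes is easy; the elements come from `used?`, which returns a representative of every
  -- code in use. By `determined` that representative equals any other element with the same code.
  codes⇒enumerable : Enumerable S
  codes⇒enumerable = decoded codes , λ x → ∈-decoded (∈codes _) (proj₂ (code x))

-- Reachability in finite automata.

-- Words are read from right to left, as in _acts_↦_.  "Reads w x" says that
-- w leads from an initial state to x.
record Automaton (A : Setoid 0ℓ 0ℓ) : Set₁ where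
  open Setoid A using (_≈_) renaming (Carrier to Letter)
  field
    State     : Set
    states    : List State
    ∈states   : ∀ x → x ∈ states
    _≟ₛ_      : DecidableEquality State
    Step      : Letter → Rel State 0ℓ
    step-resp : ∀ {x y} → (λ p → Step p x y) Respects _≈_
    step?     : ∀ p x y → Dec (Step p x y)
    Reads     : List Letter → State → Set
    start?    : ∀ x → Dec (Reads [] x)
    reads-∷   : ∀ {p w y} → Reads (p ∷ w) y ⇔ (∃[ x ] Reads w x × Step p x y)

module _ {A : Setoid 0ℓ 0ℓ} (letters : Enumerable A) (𝒜 : Automaton A) where

  open Automaton 𝒜

  private
    -- x is connected to y by a path whose inner vertices lie in the list.
    Connected : List State → Rel State 0ℓ
    Connected []       x y = x ≡ y ⊎ ∃[ p ] Step p x y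
    Connected (v ∷ vs) x y = Connected vs x y ⊎ Connected vs x v × Connected vs v y

    connected? : ∀ vs x y → Dec (Connected vs x y)
    connected? []       x y = (x ≟ₛ y) ⊎-dec ∃? letters step-resp (λ p → step? p x y)
    connected? (v ∷ vs) x y =
      connected? vs x y ⊎-dec connected? vs x v ×-dec connected? vs v y

    base : ∀ vs {x y} → Connected [] x y → Connected vs x y
    base []       c = c
    base (v ∷ vs) c = inj₁ (base vs c)

    -- Adding `v` to the permitted inner vertices changes nothing if it is permitted already.
    -- Induction on the position of `v` in the list.
    join : ∀ {vs v x y} → v ∈ vs → Connected vs x v → Connected vs v y → Connected vs x y
    join (here ≡.refl) c d = inj₂ ([ id , proj₁ ]′ c , [ id , proj₂ ]′ d)
    join (there v∈) (inj₁ c)       (inj₁ d)       = inj₁ (join v∈ c d)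
    join (there v∈) (inj₁ c)       (inj₂ (d , e)) = inj₂ (join v∈ c d , e)
    join (there v∈) (inj₂ (b , c)) (inj₁ d)       = inj₂ (b , join v∈ c d)
    -- Both paths pass through the head of the list, so the detour from there to `v` and back is cut
    -- out.
    join (there v∈) (inj₂ (b , _)) (inj₂ (_ , e)) = inj₂ (b , e)

    extend : ∀ vs {x y} → Connected vs x y → ∃[ w ] Reads w x → ∃[ w ] Reads w y
    extend []       (inj₁ ≡.refl)  r       = r
    extend []       (inj₂ (p , s)) (w , r) = p ∷ w , ⇐ reads-∷ (_ , r , s)
    extend (v ∷ vs) (inj₁ c)       = extend vs c
    extend (v ∷ vs) (inj₂ (c , d)) = extend vs d ∘ extend vs c

    connect : ∀ w {y} → Reads w y → ∃[ x ] Reads [] x × Connected states x y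
    connect []      r = _ , r , base states (inj₁ ≡.refl)
    connect (p ∷ w) r with ⇒ reads-∷ r
    ... | y , r′ , s with connect w r′
    ... | x , r₀ , c = x , r₀ , join (∈states y) c (base states (inj₂ (p , s)))

  -- Warshall's algorithm: once all states are permitted as inner vertices, `Connected` is
  -- reachability, and it was decided by recursion on the list.
  reachable? : ∀ y → Dec (∃[ w ] Reads w y)
  reachable? y = map′
    (λ (x , r , c) → extend states c ([] , r))
    (λ (w , r) → connect w r)
    (∃? {≡.setoid _} (states , ∈states) (λ { ≡.refl → id })
      (λ x → start? x ×-dec connected? states x y))

-- The product automaton: one word drives both components, so reachability in it tests whether two
-- regular languages meet.
_⊗_ : {A : Setoid 0ℓ 0ℓ} → Automaton A → Automaton A → Automaton A
𝒜 ⊗ ℬ = record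
  { State     = 𝒜.State × ℬ.State
  ; states    = cartesianProduct 𝒜.states ℬ.states
  ; ∈states   = λ (x , y) → ∈-cartesianProduct⁺ (𝒜.∈states x) (ℬ.∈states y)
  ; _≟ₛ_      = ≡-dec 𝒜._≟ₛ_ ℬ._≟ₛ_
  ; Step      = λ p (x , y) (x′ , y′) → 𝒜.Step p x x′ × ℬ.Step p y y′
  ; step-resp = λ e (s , t) → 𝒜.step-resp e s , ℬ.step-resp e t
  ; step?     = λ p (x , y) (x′ , y′) → 𝒜.step? p x x′ ×-dec ℬ.step? p y y′
  ; Reads     = λ w (x , y) → 𝒜.Reads w x × ℬ.Reads w y
  ; start?    = λ (x , y) → 𝒜.start? x ×-dec ℬ.start? y
  ; reads-∷   = mk⇔
      (λ (r , s) → let x , rx , tx = ⇒ 𝒜.reads-∷ r ; y , ry , ty = ⇒ ℬ.reads-∷ s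
                   in (x , y) , (rx , ry) , (tx , ty))
      (λ ((x , y) , (rx , ry) , (tx , ty)) →
        ⇐ 𝒜.reads-∷ (x , rx , tx) , ⇐ ℬ.reads-∷ (y , ry , ty))
  }
  where
  module 𝒜 = Automaton 𝒜
  module ℬ = Automaton ℬ

-- Enumerating the nonidentity partial isomorphisms of C.

module _ {S : Setoid 0ℓ 0ℓ} {P Q : Setoid.Carrier S → Set} where

  open Setoid S

  →-resp : P Respects _≈_ → Q Respects _≈_ → (λ x → P x → Q x) Respects _≈_
  →-resp P-resp Q-resp e f = Q-resp e ∘ f ∘ P-resp (sym e)

module _ {S : Setoid 0ℓ 0ℓ} {P Q : Setoid.Carrier S → Set} where

  open Setoid S

  ⇔-resp : P Respects _≈_ → Q Respects _≈_ → (λ x → P x ⇔ Q x) Respects _≈_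
  ⇔-resp P-resp Q-resp e f =
    mk⇔ (→-resp {S} P-resp Q-resp e (⇒ f)) (→-resp {S} Q-resp P-resp e (⇐ f))

module _ {L : Language} (C : FiniteStructure L) where

  open FiniteStructure C
  open Language L using (Symbol; arity)

  infix 4 _≐_

  _≐_ : Maybe Carrier → Carrier → Set
  m ≐ y = MaybeAny.Any (_≈ y) m

  ≐-resp : ∀ {m m′ y y′} → Pointwise _≈_ m m′ → y ≈ y′ → m ≐ y → m′ ≐ y′
  ≐-resp (just e) e′ (MaybeAny.just d) = MaybeAny.just (trans (sym e) (trans d e′))

  _≐?_ : ∀ m y → Dec (m ≐ y)
  m ≐? y = MaybeAny.dec (_≟ y) m

  at? : ∀ (p : 𝒫 C) x y → Dec (p at x ↦ y)
  at? p x y = PartialIso.to (proj₁ p) x ≐? y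

  private
    open Finite finite-domain using (enumerable)
    open Tables finite-domain (Maybe-finite finite-domain)

    tuples : ∀ R → Enumerable (Tuple.≋-setoid domain (arity R))
    tuples = Tuples-enumerable finite-domain ∘ arity

    Graph : (Carrier → Maybe Carrier) → Carrier × Carrier → Set
    Graph f (x , y) = f x ≐ y

    _≗_ : Rel (Carrier → Maybe Carrier) 0ℓ
    f ≗ f′ = ∀ x → Pointwise _≈_ (f x) (f′ x)

    module _ (f g : Carrier → Maybe Carrier) where

      -- This and the next two conditions restate the axioms of `𝒫 C` for bare partial maps.
      -- Arguments are paired so that a single `∀?` over a product decides each universal statement.
      MutuallyInverse : Set
      MutuallyInverse = ∀ xy → Graph f xy ⇔ (g (proj₂ xy) ≐ proj₁ xy)

      PreservesRelations : Set
      PreservesRelations = ∀ R (xy : (Fin (arity R) → Carrier) × (Fin (arity R) → Carrier)) →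
        (∀ j → f (proj₁ xy j) ≐ proj₂ xy j) → rel R (proj₁ xy) ⇔ rel R (proj₂ xy)

      BelowIdentity : Set
      BelowIdentity = ∀ xy → Graph f xy → proj₁ xy ≈ proj₂ xy

      Nonidentity : Set
      Nonidentity = MutuallyInverse × PreservesRelations × ¬ BelowIdentity

    module _ {f g : Carrier → Maybe Carrier} (f-cong : Congruent _≈_ (Pointwise _≈_) f)
        (g-cong : Congruent _≈_ (Pointwise _≈_) g) where

      Graph-resp : Graph f Respects Setoid._≈_ (domain ×ₛ domain)
      Graph-resp (e , e′) = ≐-resp (f-cong e) e′

      nonidentity? : Dec (Nonidentity f g)
      nonidentity? =
        ∀? pairs (⇔-resp {domain ×ₛ domain} Graph-resp (λ (e , e′) → ≐-resp (g-cong e′) e))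
          (λ (x , y) → (f x ≐? y) ⇔-dec (g y ≐? x))
        ×-dec Fin.all? (λ R → ∀? (×-enumerable (tuples R) (tuples R))
          (→-resp {tuple R ×ₛ tuple R} (λ (e , e′) fxy j → ≐-resp (f-cong (e j)) (e′ j) (fxy j))
            (⇔-resp {tuple R ×ₛ tuple R} (rel-resp R ∘ proj₁) (rel-resp R ∘ proj₂)))
          (λ (x , y) → Fin.all? (λ j → f (x j) ≐? y j) →-dec (rel? R x ⇔-dec rel? R y)))
        ×-dec ¬? (∀? pairs
          (→-resp {domain ×ₛ domain} Graph-resp (λ (e , e′) d → trans (sym e) (trans d e′)))
          (λ (x , y) → (f x ≐? y) →-dec (x ≟ y)))
        where
        pairs = ×-enumerable enumerable enumerable
        tuple : Symbol → Setoid 0ℓ 0ℓ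
        tuple R = Tuple.≋-setoid domain (arity R)

      toPartialIso : Nonidentity f g → 𝒫 C
      toPartialIso (inv , pres , nonid) = record
        { to        = f
        ; from      = g
        ; to-cong   = f-cong
        ; from-cong = g-cong
        ; to⇔from   = λ x y → inv (x , y)
        ; rel⇔      = λ R xy → pres R _ xy
        } , λ below → nonid (λ xy → below)

    fromPartialIso : ∀ ((p , _) : 𝒫 C) → Nonidentity (PartialIso.to p) (PartialIso.from p)
    fromPartialIso (p , nonid) =
      (λ _ → to⇔from _ _) , (λ R _ → rel⇔ R) , λ below → nonid (below _)
      where open PartialIso p

    nonidentity-resp : ∀ {f f′ g g′} → f ≗ f′ → g ≗ g′ → Nonidentity f g → Nonidentity f′ g′
    nonidentity-resp f≗ g≗ (inv , pres , nonid) =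
      (λ xy → mk⇔ (≐-resp (g≗ _) refl ∘ ⇒ (inv xy) ∘ ≐-resp (pw-sym (f≗ _)) refl)
                  (≐-resp (f≗ _) refl ∘ ⇐ (inv xy) ∘ ≐-resp (pw-sym (g≗ _)) refl)) ,
      (λ R xy fxy → pres R xy (λ j → ≐-resp (pw-sym (f≗ _)) refl (fxy j))) ,
      (λ below → nonid (λ xy → below xy ∘ ≐-resp (f≗ _) refl))
      where
      pw-sym : ∀ {m m′} → Pointwise _≈_ m m′ → Pointwise _≈_ m′ m
      pw-sym = Pointwise.sym sym

    _encodedBy_ : 𝒫 C → Table × Table → Set
    (p , _) encodedBy (s , t) = ⟨ s ⟩ ≗ PartialIso.to p × ⟨ t ⟩ ≗ PartialIso.from p

    used? : ∀ c → Dec (∃[ p ] p encodedBy c)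
    used? (s , t) = map′
      (λ v → toPartialIso (⟨⟩-cong s) (⟨⟩-cong t) v ,
             (λ _ → Pointwise.refl refl) , (λ _ → Pointwise.refl refl))
      (λ (p , s≗ , t≗) → nonidentity-resp (Pointwise.sym sym ∘ s≗) (Pointwise.sym sym ∘ t≗)
                                          (fromPartialIso p))
      (nonidentity? (⟨⟩-cong s) (⟨⟩-cong t))

  𝒫-enumerable : Enumerable (𝒫-setoid C)
  𝒫-enumerable = codes⇒enumerable (cartesianProduct (allFin _) (allFin _))
    (λ (s , t) → ∈-cartesianProduct⁺ (∈-allFin s) (∈-allFin t))
    _encodedBy_ used?
    (λ (p , _) → (_ , _) , ⟨table⟩ (PartialIso.to-cong p) , ⟨table⟩ (PartialIso.from-cong p))
    -- Equality in `𝒫 C` compares graphs only, so the table of the forward map is enough.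
    (λ (s≗ , _) (s≗′ , _) x y → mk⇔
      (≐-resp (Pointwise.trans trans (Pointwise.sym sym (s≗ x)) (s≗′ x)) refl)
      (≐-resp (Pointwise.trans trans (Pointwise.sym sym (s≗′ x)) (s≗ x)) refl))

  -- One-point types and the natural factorization.

  SameType : Rel Carrier 0ℓ
  SameType a b = ∀ R → rel R (const a) ⇔ rel R (const b)

  at⇒sameType : ∀ (p : 𝒫 C) {a b} → p at a ↦ b → SameType a b
  at⇒sameType (p , _) ab R = PartialIso.rel⇔ p R (const ab)

  -- Tuples from a one-point domain are constant, so the relations on constant tuples are all that a
  -- map with graph {(a, b)} has to preserve.
  sameType⇒singleton : ∀ {a b} → SameType a b → SingletonIso C a b
  sameType⇒singleton {a} {b} ab = record
    { to        = onPoint a b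
    ; from      = onPoint b a
    ; to-cong   = onPoint-cong
    ; from-cong = onPoint-cong
    ; to⇔from   = λ x y → mk⇔ (⇐ graph ∘ swap ∘ ⇒ graph) (⇐ graph ∘ swap ∘ ⇒ graph)
    ; rel⇔      = λ R xy →
        let x≈a = proj₁ ∘ ⇒ graph ∘ xy
            y≈b = proj₂ ∘ ⇒ graph ∘ xy
        in mk⇔ (rel-resp R (sym ∘ y≈b) ∘ ⇒ (ab R) ∘ rel-resp R x≈a)
               (rel-resp R (sym ∘ x≈a) ∘ ⇐ (ab R) ∘ rel-resp R y≈b)
    } , λ x y → graph
    where
    onPoint : Carrier → Carrier → Carrier → Maybe Carrier
    onPoint a b x with x ≟ a
    ... | yes _ = just b
    ... | no _  = nothing

    onPoint-cong : ∀ {a b x y} → x ≈ y → Pointwise _≈_ (onPoint a b x) (onPoint a b y)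
    onPoint-cong {a} {b} {x} {y} e with x ≟ a | y ≟ a
    ... | yes _ | yes _ = just refl
    ... | yes d | no ¬d = contradiction (trans (sym e) d) ¬d
    ... | no ¬d | yes d = contradiction (trans e d) ¬d
    ... | no _  | no _  = nothing

    graph : ∀ {a b x y} → (onPoint a b x ≐ y) ⇔ (x ≈ a × y ≈ b)
    graph {a} {b} {x} with x ≟ a
    ... | yes d = mk⇔ (λ { (MaybeAny.just e) → d , sym e }) (λ (_ , e) → MaybeAny.just (sym e))
    ... | no ¬d = mk⇔ (λ ()) (λ (d , _) → contradiction d ¬d)

  singleton⇒sameType : ∀ {a b} → SingletonIso C a b → SameType a b
  singleton⇒sameType (p , graph) R = PartialIso.rel⇔ p R (λ _ → ⇐ (graph _ _) (refl , refl))

  module _ (F : NaturalFactorization C) where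

    open NaturalFactorization F

    -- The points of the same type as `a` form a homogeneous set containing the part of `a`; by
    -- maximality they lie in that part. A partial isomorphism preserves types.
    at⇒same-class : ∀ (p : 𝒫 C) {a b} → p at a ↦ b → class a ≡ class b
    at⇒same-class p {a} ab = ≡.sym (maximal (class a) (SingletonIso C a) hom
      (homogeneous (class a) ≡.refl) (sameType⇒singleton (at⇒sameType p ab)))
      where
      hom : Homogeneous C (SingletonIso C a)
      hom ab ac = sameType⇒singleton λ R →
        let b = singleton⇒sameType ab R
            c = singleton⇒sameType ac R
        in mk⇔ (⇒ c ∘ ⇐ b) (⇒ b ∘ ⇐ c)

-- The partial action of words on the points of C.

module _ {L : Language} {C : FiniteStructure L} where

  open FiniteStructure C

  acts-resp : ∀ (w : Word C) {a a′ b b′} → a ≈ a′ → b ≈ b′ → w acts a ↦ b → w acts a′ ↦ b′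
  acts-resp []      e e′ ab            = trans (sym e) (trans ab e′)
  acts-resp (p ∷ w) e e′ (c , ac , cb) = c , acts-resp w e refl ac , at-resp p refl e′ cb

  -- Reading a word traces the image of `a`; where a letter is undefined there is no transition.
  -- States are indices of points because states need propositional equality.
  orbit : Carrier → Automaton (𝒫-setoid C)
  orbit a = record
    { State     = Fin size
    ; states    = allFin size
    ; ∈states   = ∈-allFin
    ; _≟ₛ_      = Fin._≟_
    ; Step      = λ p c d → p at decode c ↦ decode d
    ; step-resp = λ e → ⇒ (e _ _)
    ; step?     = λ p _ _ → at? C p _ _
    ; Reads     = λ w c → w acts a ↦ decode c
    ; start?    = λ c → a ≟ decode c
    ; reads-∷   = λ {p} {w} → mk⇔
        (λ (c , ac , cb) → encode c , acts-resp w refl (sym (decode-encode c)) ac ,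
                           at-resp p (sym (decode-encode c)) refl cb)
        (λ (c , ac , cb) → decode c , ac , cb)
    }
    where open Finite finite-domain

-- The action of the free group on D and its kernel.

module Evaluation {L : Language} {C : FiniteStructure L} (D : HLExtension C) where

  open HLExtension D
  open IsHLExtension isHLExtension
  private module C = FiniteStructure C
  open Group (𝔽 C) using (_⁻¹; inverseˡ; inverseʳ)

  ⟦_⟧ : Word C → Carrier → Carrier
  ⟦ w ⟧ d = foldr (Automorphism.to ∘ φ) d w

  ⟦⟧-cong : ∀ w → Congruent _≈_ _≈_ ⟦ w ⟧
  ⟦⟧-cong []      e = e
  ⟦⟧-cong (p ∷ w) e = Inverse.to-cong (Automorphism.inverse (φ p)) (⟦⟧-cong w e)

  ⟦⟧-++ : ∀ u v d → ⟦ u ++ v ⟧ d ≈ ⟦ u ⟧ (⟦ v ⟧ d)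
  ⟦⟧-++ u v d = reflexive (foldr-++ _ d u v)

  infix 4 _≋_

  _≋_ : Rel (Word C) 0ℓ
  u ≋ v = ∀ d → ⟦ u ⟧ d ≈ ⟦ v ⟧ d

  -- The words act through the free group: the convention that `φ` commutes with inverses yields
  -- `cancel`, and `φ-cong` yields `letter`.
  ∼⇒≋ : ∀ {u v} → u ∼ v → u ≋ v
  ∼⇒≋ ∼-refl        d = refl
  ∼⇒≋ (∼-sym e)     d = sym (∼⇒≋ e d)
  ∼⇒≋ (∼-trans e f) d = trans (∼⇒≋ e d) (∼⇒≋ f d)
  ∼⇒≋ (++-cong {u} {u′} {v} {v′} e f) d = begin
    ⟦ u ++ v ⟧ d     ≈⟨ ⟦⟧-++ u v d ⟩
    ⟦ u ⟧ (⟦ v ⟧ d)    ≈⟨ ⟦⟧-cong u (∼⇒≋ f d) ⟩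
    ⟦ u ⟧ (⟦ v′ ⟧ d)   ≈⟨ ∼⇒≋ e _ ⟩
    ⟦ u′ ⟧ (⟦ v′ ⟧ d)  ≈⟨ ⟦⟧-++ u′ v′ d ⟨
    ⟦ u′ ++ v′ ⟧ d   ∎
    where open SetoidReasoning domain
  ∼⇒≋ (letter {p} {q} e) d = φ-cong {p} {q} e d
  ∼⇒≋ (cancel p) d = trans (Inverse.to-cong (Automorphism.inverse (φ p)) (φ-⁻¹ p d))
                           (Inverse.strictlyInverseˡ (Automorphism.inverse (φ p)) d)

  -- Each `φ p` extends `p`, so the total action on D agrees with the partial action on C wherever
  -- the latter is defined.
  acts⇒⟦⟧ : ∀ w {a b} → w acts a ↦ b → ⟦ w ⟧ (ι a) ≈ ι b
  acts⇒⟦⟧ []      ab            = IsEmbedding.cong isEmbedding ab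
  acts⇒⟦⟧ (p ∷ w) (c , ac , cb) =
    trans (⟦⟧-cong [ p ] (acts⇒⟦⟧ w ac)) (φ-extends p cb)

  Kernel : Word C → Set
  Kernel w = w ≋ []

  move-left : ∀ {g h d d′} → ⟦ g ⁻¹ ++ h ⟧ d ≈ d′ ⇔ ⟦ g ⟧ d′ ≈ ⟦ h ⟧ d
  move-left {g} {h} {d} {d′} = mk⇔
    (λ e → begin
      ⟦ g ⟧ d′                   ≈⟨ ⟦⟧-cong g e ⟨
      ⟦ g ⟧ (⟦ g ⁻¹ ++ h ⟧ d)    ≈⟨ ⟦⟧-++ g (g ⁻¹ ++ h) d ⟨
      ⟦ g ++ (g ⁻¹ ++ h) ⟧ d     ≈⟨ ∼⇒≋ (\\-leftDividesˡ g h) d ⟩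
      ⟦ h ⟧ d                    ∎)
    (λ e → begin
      ⟦ g ⁻¹ ++ h ⟧ d            ≈⟨ ⟦⟧-++ (g ⁻¹) h d ⟩
      ⟦ g ⁻¹ ⟧ (⟦ h ⟧ d)         ≈⟨ ⟦⟧-cong (g ⁻¹) e ⟨
      ⟦ g ⁻¹ ⟧ (⟦ g ⟧ d′)        ≈⟨ ⟦⟧-++ (g ⁻¹) g d′ ⟨
      ⟦ g ⁻¹ ++ g ⟧ d′           ≈⟨ ∼⇒≋ (inverseˡ g) d′ ⟩
      d′                         ∎)
    where
    open SetoidReasoning domain
    open GroupProperties (𝔽 C)

  kernel-coset : ∀ {g h} → Kernel (g ⁻¹ ++ h) ⇔ g ≋ h
  kernel-coset {g} {h} = mk⇔ (λ k d → ⇒ (move-left {g}) (k d)) (λ e d → ⇐ (move-left {g}) (e d))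

  kernel-isSubgroup : IsSubgroup (𝔽 C) Kernel
  kernel-isSubgroup = record
    { resp      = λ e k d → trans (sym (∼⇒≋ e d)) (k d)
    ; ε-closed  = λ d → refl
    ; ∙-closed  = λ {u} {v} k l d → trans (⟦⟧-++ u v d) (trans (⟦⟧-cong u (l d)) (k d))
    ; ⁻¹-closed = λ {u} k d → trans (sym (⟦⟧-cong (u ⁻¹) (k d)))
                                    (trans (sym (⟦⟧-++ (u ⁻¹) u d)) (∼⇒≋ (inverseˡ u) d))
    }

  kernel-normal : ∀ g {u} → Kernel u → Kernel ((g ++ u) ++ g ⁻¹)
  kernel-normal g {u} k d = begin
    ⟦ (g ++ u) ++ g ⁻¹ ⟧ d     ≈⟨ ⟦⟧-++ (g ++ u) (g ⁻¹) d ⟩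
    ⟦ g ++ u ⟧ (⟦ g ⁻¹ ⟧ d)    ≈⟨ ⟦⟧-++ g u _ ⟩
    ⟦ g ⟧ (⟦ u ⟧ (⟦ g ⁻¹ ⟧ d))  ≈⟨ ⟦⟧-cong g (k _) ⟩
    ⟦ g ⟧ (⟦ g ⁻¹ ⟧ d)         ≈⟨ ⟦⟧-++ g (g ⁻¹) d ⟨
    ⟦ g ++ g ⁻¹ ⟧ d            ≈⟨ ∼⇒≋ (inverseʳ g) d ⟩
    d                          ∎
    where open SetoidReasoning domain

  KernelCosets : Setoid 0ℓ 0ℓ
  KernelCosets = leftCosets (𝔽 C) Kernel kernel-isSubgroup

  -- Finite index of the kernel and membership in its product with a stabilizer.

  module _ (finite : IsFinite structure) where

    open IsFinite finite
    open Finite finite-domain using (enumerable)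
    open Finite C.finite-domain using (encode; decode-encode)
    open Tables finite-domain finite-domain

    ≋? : Decidable _≋_
    ≋? u v = ∀? enumerable (λ e f → trans (⟦⟧-cong u (sym e)) (trans f (⟦⟧-cong v e)))
                (λ d → ⟦ u ⟧ d ≟ ⟦ v ⟧ d)

    -- The state after a word is the value table of its action on D; a further letter composes on
    -- the left, which matches reading from right to left.
    action : Automaton (𝒫-setoid C)
    action = record
      { State     = Table
      ; states    = allFin _
      ; ∈states   = ∈-allFin
      ; _≟ₛ_      = Fin._≟_
      ; Step      = λ p s t → ∀ d → ⟨ t ⟩ d ≈ ⟦ [ p ] ⟧ (⟨ s ⟩ d)
      ; step-resp = λ {_} {_} {p} {q} e st d → trans (st d) (φ-cong {p} {q} e _)
      ; step?     = λ p s t → ≗? (⟨⟩-cong t) (⟦⟧-cong [ p ] ∘ ⟨⟩-cong s)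
      ; Reads     = λ w t → ∀ d → ⟨ t ⟩ d ≈ ⟦ w ⟧ d
      ; start?    = λ t → ≗? (⟨⟩-cong t) id
      ; reads-∷   = λ {p} {w} → mk⇔
          (λ r → table ⟦ w ⟧ , ⟨table⟩ (⟦⟧-cong w) , λ d →
            trans (r d) (⟦⟧-cong [ p ] (sym (⟨table⟩ (⟦⟧-cong w) d))))
          (λ (_ , r , st) d → trans (st d) (⟦⟧-cong [ p ] (r d)))
      }
      where
      ≗? : ∀ {f g : Carrier → Carrier} → Congruent _≈_ _≈_ f → Congruent _≈_ _≈_ g →
           Dec (∀ d → f d ≈ g d)
      ≗? f-cong g-cong = ∀? enumerable (λ e r → trans (f-cong (sym e)) (trans r (g-cong e)))
                            (λ _ → _ ≟ _)

    -- A kernel coset is determined by the table of its action, and the tables that occur are the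
    -- reachable states of `action`.
    kernelCosets-enumerable : Enumerable KernelCosets
    kernelCosets-enumerable = codes⇒enumerable (allFin _) ∈-allFin
      (Automaton.Reads action) (reachable? (𝒫-enumerable C) action)
      (λ w → table ⟦ w ⟧ , ⟨table⟩ (⟦⟧-cong w))
      (λ {u} {v} ru rv → ⇐ (kernel-coset {u} {v}) (λ d → trans (sym (ru d)) (rv d)))

    kernel : FiniteIndexNormalSubgroup (𝔽 C)
    kernel = record
      { member      = Kernel
      ; isSubgroup  = kernel-isSubgroup
      ; conj-closed = λ g → kernel-normal g
      ; finiteIndex = enumerable⇒finite
          (λ u v → map′ (⇐ (kernel-coset {u} {v})) (⇒ (kernel-coset {u} {v})) (≋? u v))
          kernelCosets-enumerable
      }

    InKernelTimesStabilizer : C.Carrier → Word C → Set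
    InKernelTimesStabilizer a = productSet (𝔽 C) kernel (stabilizerSubgroup C a)

    -- A kernel factor is invisible in D, so a product acts as its stabilizer factor. Conversely, if
    -- `g` and `w` act alike, then `g` is `(g ++ w ⁻¹) ++ w` in the free group, and `g ++ w ⁻¹` lies
    -- in the kernel.
    kernelTimesStabilizer⇔ : ∀ {a g} →
      InKernelTimesStabilizer a g ⇔ (∃[ w ] g ≋ w × w acts a ↦ a)
    kernelTimesStabilizer⇔ {a} {g} = mk⇔
      (λ (x , h , kx , (w , w∼h , wa) , g∼xh) → w ,
        (λ d → trans (∼⇒≋ g∼xh d) (trans (⟦⟧-++ x h d) (trans (kx _) (sym (∼⇒≋ w∼h d))))) , wa)
      (λ (w , g≋w , wa) → g ++ w ⁻¹ , w ,
        (λ d → trans (⟦⟧-++ g (w ⁻¹) d) (trans (g≋w _)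
          (trans (sym (⟦⟧-++ w (w ⁻¹) d)) (∼⇒≋ (inverseʳ w) d)))) ,
        (w , ∼-refl , wa) ,
        ∼-sym (GroupProperties.//-rightDividesˡ (𝔽 C) w g))

    kernelTimesStabilizer? : ∀ a → Unary.Decidable (InKernelTimesStabilizer a)
    kernelTimesStabilizer? a g = map′
      (λ (w , r , wa) → ⇐ kernelTimesStabilizer⇔
        (w , (λ d → trans (sym (⟨table⟩ (⟦⟧-cong g) d)) (r d)) ,
         acts-resp w C.refl (decode-encode a) wa))
      (λ k → let w , g≋w , wa = ⇒ kernelTimesStabilizer⇔ k
             in w , (λ d → trans (⟨table⟩ (⟦⟧-cong g) d) (g≋w d)) ,
                acts-resp w C.refl (C.sym (decode-encode a)) wa)
      -- The target state asks for one word that acts on D as `g` does and returns `a` to itself.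
      (reachable? (𝒫-enumerable C) (action ⊗ orbit a) (table ⟦ g ⟧ , encode a))

-- The coset structure of the kernel as an HL-extension mapping onto D.

module Quotient {L : Language} {C : FiniteStructure L} (F : NaturalFactorization C)
    (D : HLExtension C) (finite : IsFinite (HLExtension.structure D)) where

  open NaturalFactorization F
  open Evaluation D
  private
    module C = FiniteStructure C
    module D where
      open HLExtension D public
      open IsHLExtension isHLExtension public
      open IsEmbedding isEmbedding public using (injective) renaming (rel⇔ to ι-rel⇔)

  K : Fin n → FiniteIndexNormalSubgroup (𝔽 C)
  K _ = kernel finite

  open Construction C F K hiding (Γ; Φ; π; Γ-extension)
  open Structure (Γ C F K) using (rel; _≈_; refl; sym; trans)

  ≋⇒≈ : ∀ {i g h} → g ≋ h → (i , g) ≈ (i , h)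
  ≋⇒≈ {i} {g} {h} e = coset (⇐ (kernelTimesStabilizer⇔ finite)
    ([] , ⇐ (kernel-coset {g} {h}) e , C.refl))

  -- The word `invert u ++ v` is defined at the chosen point and fixes it.
  acts⇒≈ : ∀ {i u v a} → u acts point i ↦ a → v acts point i ↦ a → (i , u) ≈ (i , v)
  acts⇒≈ {u = u} {v} ua va = coset (⇐ (kernelTimesStabilizer⇔ finite)
    (invert u ++ v , (λ _ → D.refl) , acts-++ (invert u) va (acts-invert u ua)))

  Φ-cong : ∀ p {x y} → x ≈ y → Automorphism.to (Φ C F K p) x ≈ Automorphism.to (Φ C F K p) y
  Φ-cong p = Inverse.to-cong (Automorphism.inverse (Φ C F K p))

  _≈?_ : Decidable _≈_
  (i , g) ≈? (j , h) with i Fin.≟ j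
  ... | no i≢j     = no λ { (coset _) → i≢j ≡.refl }
  ... | yes ≡.refl = map′ coset (λ { (coset k) → k })
                          (kernelTimesStabilizer? finite (point i) (invert g ++ h))

  at₁⇒acts : ∀ q {a b} → q at₁ a ↦ b → word₁ q acts a ↦ b
  at₁⇒acts nothing  ab = ab
  at₁⇒acts (just _) ab = _ , C.refl , ab

  at₁-resp : ∀ q {a b b′} → b C.≈ b′ → q at₁ a ↦ b → q at₁ a ↦ b′
  at₁-resp nothing  e ab = C.trans ab e
  at₁-resp (just p) e ab = at-resp p C.refl e ab

  word₁-reaching : ∀ a → ∃[ q ] (q at₁ point (class a) ↦ a) × π C F K a ≈ (class a , word₁ q)
  -- Splitting in an auxiliary function keeps `π` folded in the goal, so that `π-point` and
  -- `π-moved` apply.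
  word₁-reaching a = reaching (a C.≟ point (class a))
    where
    reaching : Dec (a C.≈ point (class a)) →
               ∃[ q ] (q at₁ point (class a) ↦ a) × π C F K a ≈ (class a , word₁ q)
    reaching (yes a≈) = nothing , C.sym a≈ , π-point a a≈
    reaching (no a≉) with homogeneous (class a) (point∈ (class a)) ≡.refl
    ... | p , graph = just p′ , moves , π-moved a a≉ p′ moves
      where
      moves = ⇐ (graph (point (class a)) a) (C.refl , C.refl)
      p′ : 𝒫 C
      p′ = p , λ id → a≉ (C.sym (id moves))

  -- Frees `π` from its chosen representative: that one and `u` both take the chosen point to `a`,
  -- hence give one coset.
  π-acts : ∀ {i u a} → class a ≡ i → u acts point i ↦ a → π C F K a ≈ (i , u)
  π-acts ≡.refl ua with word₁-reaching _
  ... | q , qa , e = trans e (acts⇒≈ (at₁⇒acts q qa) ua)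

  ψ : Fin n × Word C → D.Carrier
  ψ (i , g) = ⟦ g ⟧ (D.ι (point i))

  -- Representatives of one coset differ by a word that acts on D like some `w` fixing the chosen
  -- point in C, and `w` then fixes the image of this point in D.
  ψ-cong : Congruent _≈_ D._≈_ ψ
  ψ-cong (coset {i} {g} {h} k) with ⇒ (kernelTimesStabilizer⇔ finite) k
  ... | w , e , wa = ⇒ (move-left {g}) (D.trans (e _) (acts⇒⟦⟧ w wa))

  ψ-π : ∀ a → ψ (π C F K a) D.≈ D.ι a
  ψ-π a with word₁-reaching a
  ... | q , qa , e = D.trans (ψ-cong e) (acts⇒⟦⟧ (word₁ q) (at₁⇒acts q qa))

  ⟦⟧-rel : ∀ w R x → D.rel R x → D.rel R (⟦ w ⟧ ∘ x)
  ⟦⟧-rel []      R x r = r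
  ⟦⟧-rel (p ∷ w) R x r = ⇒ (Automorphism.rel⇔ (D.φ p) R _) (⟦⟧-rel w R x r)

  -- A related tuple is a translate by `g` of a related tuple of C. Its image in D is the latter
  -- tuple moved by the automorphism `⟦ g ⟧`.
  ψ-hom : Hom (Γ C F K) D.structure
  ψ-hom = record
    { to        = ψ
    ; cong      = ψ-cong
    ; preserves = λ R x r → let open RelΓ r in
        D.rel-resp R
          (λ j → D.sym (D.trans (ψ-cong (x≈ j)) (D.trans (⟦⟧-++ g (word₁ (p j)) _)
            (⟦⟧-cong g (acts⇒⟦⟧ (word₁ (p j)) (at₁⇒acts (p j) (p-at j)))))))
          (⟦⟧-rel g R _ (⇒ (D.ι-rel⇔ R c) holds))
    }

  isHL : IsHLExtension C (Γ C F K) (π C F K) (Φ C F K)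
  isHL = record
    { isEmbedding = record
      { cong      = λ {a} {b} a≈b → let q , qa , e = word₁-reaching a in
          trans e (sym (π-acts (≡.sym (class-cong a≈b))
            (acts-resp (word₁ q) C.refl a≈b (at₁⇒acts q qa))))
      -- The composite of `ψ` with `π` is `ι`, which is injective.
      ; injective = λ {a} {b} e →
          D.injective (D.trans (D.sym (ψ-π a)) (D.trans (ψ-cong e) (ψ-π b)))
      ; rel⇔      = λ R x → mk⇔
          (λ r → record
            { i     = class ∘ x
            ; p     = proj₁ ∘ word₁-reaching ∘ x
            ; g     = []
            ; c     = x
            ; p-at  = proj₁ ∘ proj₂ ∘ word₁-reaching ∘ x
            ; x≈    = proj₂ ∘ proj₂ ∘ word₁-reaching ∘ x
            ; holds = r
            })
          -- Relations are reflected by a detour through D: `ψ` carries them there, and `ι` reflects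
          -- them back to C.
          (λ r → ⇐ (D.ι-rel⇔ R x) (D.rel-resp R (ψ-π ∘ x) (Hom.preserves ψ-hom R _ r)))
      }
    ; φ-cong      = λ {p} {q} e (i , g) → ≋⇒≈ (λ d → D.φ-cong {p} {q} e (⟦ g ⟧ d))
    -- Prefixing `p` to a word reaching `a` gives a word reaching `b` from the same chosen point,
    -- since `a` and `b` share a part.
    ; φ-extends   = λ p {a} {b} ab → let q , qa , e = word₁-reaching a in
        trans (Φ-cong p e) (sym (π-acts (≡.sym (at⇒same-class C F p ab))
          (a , at₁⇒acts q qa , ab)))
    ; φ-⁻¹        = λ _ _ → refl
    }

  E : HLExtension C
  E = Γ-extension C F K isHL

  ψ-HLHom : HLHom E D
  ψ-HLHom = record { hom = ψ-hom ; fixes-C = ψ-π ; commutes = λ _ _ → D.refl }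

  generated : ∀ g {x i u} → x ≈ (i , u) →
              (i , g ++ u) ≈ foldr (Automorphism.to ∘ Φ C F K) x g
  generated []      e = sym e
  generated (p ∷ g) e = Φ-cong p (generated g e)

  -- Every coset is `g` applied to the coset of the empty word, and the latter is the image under
  -- `π` of the chosen point.
  minimal : Minimal E
  minimal (i , g) _ = g , point i ,
    ≡.subst (λ h → (i , h) ≈ foldr (Automorphism.to ∘ Φ C F K) (π C F K (point i)) g)
      (++-identityʳ g) (generated g (π-acts (point∈ i) C.refl))

  ψ-surjective : Minimal D → Surjective _≈_ D._≈_ ψ
  ψ-surjective D-minimal b =
    let x , e = preimage in x , λ z≈x → D.trans (ψ-cong z≈x) e
    where
    preimage : ∃[ x ] ψ x D.≈ b
    -- Minimality speaks only of points outside C, so membership in the image of `ι` is decided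
    -- first.
    preimage with ∃? (Finite.enumerable C.finite-domain)
                     (λ c≈c′ e → D.trans (D.sym (IsEmbedding.cong D.isEmbedding c≈c′)) e)
                     (λ c → IsFinite._≟_ finite (D.ι c) b)
    ... | yes (c , e) = π C F K c , D.trans (ψ-π c) e
    ... | no b∉C with D-minimal b b∉C
    ... | w , a , e = let i , g = π C F K a in
      (i , w ++ g) , D.trans (⟦⟧-++ w g _) (D.trans (⟦⟧-cong w (ψ-π a)) (D.sym e))

  -- Finiteness of the coset structure.

  private
    -- The demand of `RelΓ` on one coordinate. Once `g` and the tuple in C are fixed, the
    -- coordinates can be decided separately; the part index is read off `x`, as equal cosets share
    -- it.
    Entry : Fin n × Word C → Word C → C.Carrier → Set
    Entry x@(i , _) g c = ∃[ q ] (q at₁ point i ↦ c) × x ≈ (i , g ++ word₁ q)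

    entry : ∀ {x i g c} q → q at₁ point i ↦ c → x ≈ (i , g ++ word₁ q) → Entry x g c
    entry q qc e@(coset _) = q , qc , e

    entry? : ∀ x g c → Dec (Entry x g c)
    entry? x@(i , _) g c = map′
      (λ { (inj₁ (e , x≈)) → nothing , e , x≈ ; (inj₂ (p , pc , x≈)) → just p , pc , x≈ })
      (λ { (nothing , e , x≈) → inj₁ (e , x≈) ; (just p , pc , x≈) → inj₂ (p , pc , x≈) })
      ((point i C.≟ c ×-dec x ≈? (i , g ++ []))
       ⊎-dec ∃? (𝒫-enumerable C)
         (λ {p} {q} e (pc , x≈) → ⇒ (e _ _) pc ,
           trans x≈ (≋⇒≈ (λ d → ∼⇒≋ (++-cong {u = g} ∼-refl (letter {p = p} {q} e)) d)))
         (λ p → at? C p (point i) c ×-dec x ≈? (i , g ++ [ p ])))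

    entry-resp : ∀ {x g h b c} → g ≋ h → b C.≈ c → Entry x g b → Entry x h c
    entry-resp {g = g} {h} e b≈c (q , qb , x≈) = q , at₁-resp q b≈c qb ,
      trans x≈ (≋⇒≈ (λ d → D.trans (⟦⟧-++ g (word₁ q) d)
        (D.trans (e _) (D.sym (⟦⟧-++ h (word₁ q) d)))))

  -- `Entry` depends on `g` only through its action on D, so the search for `g` runs over
  -- representatives of the finitely many kernel cosets.
  rel? : ∀ R x → Dec (rel R x)
  rel? R x = map′
    (λ (g , c , r , entries) → record
      { i     = proj₁ ∘ x
      ; p     = proj₁ ∘ entries
      ; g     = g
      ; c     = c
      ; p-at  = proj₁ ∘ proj₂ ∘ entries
      ; x≈    = proj₂ ∘ proj₂ ∘ entries
      ; holds = r
      })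
    (λ r → let open RelΓ r in g , c , holds , λ j → entry (p j) (p-at j) (x≈ j))
    (∃? (kernelCosets-enumerable finite)
      (λ {g} {h} k (c , r , entries) → c , r , λ j →
        entry-resp (⇒ (kernel-coset {g} {h}) k) C.refl (entries j))
      (λ g → ∃? (Tuples-enumerable C.finite-domain _)
        (λ e (r , entries) → C.rel-resp R e r , λ j →
          entry-resp {g = g} (λ _ → D.refl) (e j) (entries j))
        (λ c → C.rel? R c ×-dec Fin.all? (λ j → entry? (x j) g (c j)))))

  isFinite : IsFinite (Γ C F K)
  isFinite = record
    { finite-domain = enumerable⇒finite _≈?_
        -- Words in one kernel coset give one point in each part of Γ, so pairs of an index and a
        -- kernel coset cover Γ; repetitions are removed by `enumerable⇒finite`.
        (_ , λ x@(_ , g) → Any.map (λ { {_ , h} (≡.refl , k) → ≋⇒≈ (⇒ (kernel-coset {g} {h}) k) })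
                                   (∈Fin×Cosets x))
    ; rel? = rel?
    }
    where
    open Enumerable
      (×-enumerable (Finite.enumerable (Fin-finite n)) (kernelCosets-enumerable finite))
      renaming (enumeration to ∈Fin×Cosets)

theorem2p4 : (L : Language) (𝒯 : List (FiniteStructure L)) (C : FiniteStructure L) →
    Free 𝒯 (FiniteStructure.structure C) →
    (F : NaturalFactorization C) →
    (D : HLExtension C) →
    IsFinite (HLExtension.structure D) →
    Free 𝒯 (HLExtension.structure D) →
    Minimal D →
    Σ[ N ∈ (Fin (NaturalFactorization.n F) → FiniteIndexNormalSubgroup (𝔽 C)) ]
    Σ[ isHL ∈ IsHLExtension C (Γ C F N) (π C F N) (Φ C F N) ]
    let E = Γ-extension C F N isHL in
    IsFinite (Γ C F N)
    × Free 𝒯 (Γ C F N)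
    × Minimal E
    × (Σ[ h ∈ HLHom E D ] Surjective (HLExtension._≈_ E) (HLExtension._≈_ D) (HLHom.ψ h))
theorem2p4 L 𝒯 C _ F D finite free D-minimal =
  K , isHL , isFinite , All.map (λ ¬hom f → ¬hom (ψ-hom ∘ʰ f)) free ,
  minimal , ψ-HLHom , ψ-surjective D-minimal
  where
  open Quotient F D finite
  _∘ʰ_ : ∀ {A B E : Structure L} → Hom B E → Hom A B → Hom A E
  g ∘ʰ f = record
    { to        = Hom.to g ∘ Hom.to f
    ; cong      = Hom.cong g ∘ Hom.cong f
    ; preserves = λ R x → Hom.preserves g R _ ∘ Hom.preserves f R x
    }
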